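{- In the random-order secretary problem with $n$ items and a single uniform signal (defined in the context), the policy $\mathcal{A}(S)$ has success probability exactly $\frac1n+\frac{n-1}{2n}=\frac{n+1}{2n}>\frac12$.
   Context: Notation: $[n]=\{1,\dots,n\}$. Random-order secretary problem with a uniform signal: $n\ge 1$ items with distinct values arrive one by one at times $1,\dots,n$ in uniformly random order. Let $I\in[n]$ be the arrival time of the best item. After the arrival order has been fixed, a signal time $S$ is drawn uniformly from $[I]$, depending on the order only through $I$. At each time $t$ the policy observes the relative rank of the item arriving at time $t$ among the first $t$ items, and whether the signal occurs at time $t$ ($S=t$); it then irrevocably decides whether to stop at time $t$. A policy succeeds if it stops exactly at time $I$. A time is a record if the item arriving then is the best item so far. The policy $\mathcal{A}(S)$ rejects all items before time $S$ and accepts the first record at a time in $\{S,\dots,n\}$. -}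

module Defs where

open import Data.Bool.Base using (Bool; _∧_; _∨_)
open import Data.Bool.ListAction using (any)
open import Data.Fin.Base using (Fin; zero; toℕ)
import Data.Fin.Properties as Fin
open import Data.Integer.Base using (1ℤ)
open import Data.List.Base
  using (List; []; _∷_; allFin; cartesianProductWith; concatMap; filter;
         findᵇ; foldr; length; map; tabulate; take)
import Data.List.Extrema as Extrema
open import Data.Maybe.Base using (Maybe; just)
import Data.Maybe.Properties as Maybe
open import Data.Nat.Base as ℕ using (ℕ; zero; suc; NonZero; _≡ᵇ_)
open import Data.Product.Base using (_×_; _,_; proj₁; proj₂)
open import Data.Rational.Base using (ℚ; 0ℚ; 1ℚ; _+_; _*_; _/_)
open import Data.Vec.Base as Vec using (Vec; []; _∷_)
import Data.Vec.Relation.Unary.AllPairs as AllPairs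
open import Data.Vec.Relation.Unary.Unique.Propositional using (Unique)
open import Relation.Binary.Bundles using (DecTotalOrder)
open import Relation.Binary.PropositionalEquality using (_≡_)
open import Relation.Nullary.Decidable using (does; ¬?; _×-dec_)
open import Relation.Unary using (Pred; Decidable)

------------------------------------------------------------------------
-- Finite probability: a distribution is a list of weighted outcomes.

Dist : ∀ {a} → Set a → Set a
Dist A = List (A × ℚ)

-- The uniform distribution on the entries of a list; used below only for
-- nonempty duplicate-free lists.
uniform : ∀ {a} {A : Set a} → List A → Dist A
uniform []          = []
uniform xs@(_ ∷ ys) = map (λ x → x , 1ℤ / suc (length ys)) xs

pure : ∀ {a} {A : Set a} → A → Dist A
pure x = (x , 1ℚ) ∷ []

infixl 1 _>>=_
_>>=_ : ∀ {a b} {A : Set a} {B : Set b} → Dist A → (A → Dist B) → Dist B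
d >>= f = concatMap (λ (x , p) → map (λ (y , q) → y , p * q) (f x)) d

Pr : ∀ {a p} {A : Set a} {P : Pred A p} → Dist A → Decidable P → ℚ
Pr d P? = foldr _+_ 0ℚ (map proj₂ (filter (λ (x , _) → P? x) d))

------------------------------------------------------------------------
-- Arrival orders.  The t-th entry is the item arriving at time t, and times
-- 1, …, n are represented by the elements 0, …, n − 1 of Fin n.

allVecs : ∀ {a} {A : Set a} → List A → (k : ℕ) → List (Vec A k)
allVecs xs zero    = [] ∷ []
allVecs xs (suc k) = cartesianProductWith _∷_ xs (allVecs xs k)

unique? : ∀ {n k} → Decidable (Unique {A = Fin n} {k})
unique? = AllPairs.allPairs? (λ i j → ¬? (i Fin.≟ j))

arrivalOrders : (n : ℕ) → List (Vec (Fin n) n)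
arrivalOrders n = filter unique? (allVecs (allFin n) n)

------------------------------------------------------------------------
-- Policies.

record Observation : Set where
  constructor observation
  field
    relativeRank : ℕ      -- 1 is the best rank
    signal       : Bool

open Observation public

-- Given the observations at all earlier times (oldest first) and the present
-- one, a policy says whether it stops now, if it has not stopped before.
Policy : Set
Policy = List Observation → Observation → Bool

-- 𝒜(S).  The observations reveal that S ≤ t exactly when the signal has
-- occurred at some time up to t, and that t is a record exactly when the
-- relative rank is 1.
𝒜 : Policy
𝒜 past now = (any signal past ∨ signal now) ∧ (relativeRank now ≡ᵇ 1)

------------------------------------------------------------------------
-- The random-order secretary problem with a uniform signal, for item values
-- in an arbitrary decidable total order; greater values are better.

module Secretary {c ℓ₁ ℓ₂} (O : DecTotalOrder c ℓ₁ ℓ₂) where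

  open DecTotalOrder O using (_≤?_; totalOrder) renaming (Carrier to Value)
  open Extrema totalOrder using (argmax)

  -- Below, x t is the value of the item arriving at time t.

  bestTime : ∀ {n} .{{_ : NonZero n}} → (Fin n → Value) → Fin n
  bestTime {suc n} x = argmax x zero (allFin (suc n))

  rank : ∀ {n} → (Fin n → Value) → Fin n → ℕ
  rank {n} x t = suc (length (filter better? (allFin n)))
    where
    better? = λ u → (u Fin.<? t) ×-dec ¬? (x u ≤? x t)

  observe : ∀ {n} → (Fin n → Value) → (s : Fin n) → Fin n → Observation
  observe x s t = observation (rank x t) (does (s Fin.≟ t))

  stopTime : ∀ {n} → Policy → (Fin n → Value) → (s : Fin n) → Maybe (Fin n)
  stopTime {n} π x s = findᵇ stops (allFin n)
    where
    stops : Fin n → Bool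
    stops t = π (take (toℕ t) (tabulate (observe x s))) (observe x s t)

  Succeeds : ∀ {n} .{{_ : NonZero n}} →
             Policy → (Fin n → Value) × Fin n → Set
  Succeeds π (x , s) = stopTime π x s ≡ just (bestTime x)

  succeeds? : ∀ {n} .{{_ : NonZero n}} (π : Policy) →
              Decidable (Succeeds {n} π)
  succeeds? π (x , s) = Maybe.≡-dec Fin._≟_ (stopTime π x s) (just (bestTime x))

  -- The joint law of the arriving values and the signal time S, where v i is
  -- the value of item i.
  experiment : ∀ {n} .{{_ : NonZero n}} →
               (Fin n → Value) → Dist ((Fin n → Value) × Fin n)
  experiment {n} v =
    uniform (arrivalOrders n) >>= λ σ →
    let x = λ t → v (Vec.lookup σ t) in
    uniform (filter (Fin._≤? bestTime x) (allFin n)) >>= λ s →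
    pure (x , s)

  successProbability : ∀ {n} .{{_ : NonZero n}} →
                       (Fin n → Value) → Policy → ℚ
  successProbability v π = Pr (experiment v) (succeeds? π)

{-# OPTIONS --safe #-}

-- Let i be the best time and, for i > 0, let j < i be the time of the best item among those
-- arriving before time i.  As j is the last record before i, 𝒜 succeeds from the signal time
-- s ≤ i exactly when j < s.  Reversing the order of the items arriving before time i turns j into
-- i - 1 - j, and i - 1 - j < i - s holds exactly when j < s does not.  So, given i > 0, the
-- measure-preserving involution which reverses these items and replaces s by i - s exchanges
-- success and failure, and 𝒜 succeeds with probability 1/2.  At i = 0, which has probability
-- 1/n, it always succeeds.  Times are counted from 0 here.

module Submission where

import Algebra.Properties.CommutativeSemigroup as CommutativeSemigroupProperties
open import Algebra.Bundles using (CommutativeMonoid)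
open import Data.Bool.Base using (Bool; true; false; T; _∨_; if_then_else_)
open import Data.Bool.ListAction using (any)
open import Data.Bool.Properties using (T-≡; T-∧; T-∨)
open import Data.Fin.Base using (Fin; zero; suc; toℕ; fromℕ<)
import Data.Fin.Properties as Fin
open import Data.Integer.Base as ℤ using (+_; 1ℤ)
import Data.Integer.Tactic.RingSolver as ℤ
open import Data.List.Base
  using (List; []; _∷_; _++_; allFin; filter; findᵇ; foldr; length; map; tabulate; take)
import Data.List.Extrema as Extrema
open import Data.List.Membership.Propositional using (_∈_)
open import Data.List.Membership.Propositional.Properties
  using (∈-allFin; ∈-cartesianProductWith⁺; ∈-filter⁺; ∈-filter⁻; ∈-map⁺; ∈-map⁻)
open import Data.List.Membership.Propositional.Properties.WithK using (unique∧set⇒bag)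
open import Data.List.Properties using (filter-none; length-tabulate)
open import Data.List.Relation.Binary.BagAndSetEquality using (∼bag⇒↭)
open import Data.List.Relation.Binary.Permutation.Propositional using (_↭_; ↭⇒↭ₛ)
import Data.List.Relation.Binary.Permutation.Propositional.Properties as ↭
import Data.List.Relation.Binary.Permutation.Setoid.Properties as Permutation
open import Data.List.Relation.Unary.All as All using ([]; _∷_)
import Data.List.Relation.Unary.All.Properties as All
open import Data.List.Relation.Unary.AllPairs using ([]; _∷_)
open import Data.List.Relation.Unary.Any using (here; there)
import Data.List.Relation.Unary.Unique.Propositional as List
import Data.List.Relation.Unary.Unique.Propositional.Properties as List
open import Data.Maybe.Base using (just)
open import Data.Maybe.Properties as Maybe using (just-injective)
open import Data.Nat.Base as ℕ
  using (ℕ; zero; suc; NonZero; _≤_; _<_; _∸_; _≡ᵇ_; z≤n; s≤s; z<s; s<s)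
import Data.Nat.Properties as ℕ
open import Data.Nat.Properties using (m*n≢0)
open import Data.Product.Base using (_×_; _,_; proj₂; ∃-syntax)
open import Data.Rational.Base using (ℚ; 0ℚ; 1ℚ; ½; _+_; _*_; _/_; _>_; fromℚᵘ)
open import Data.Rational.Properties
  using (+-0-commutativeMonoid; +-0-isCommutativeMonoid; +-assoc; +-identityˡ;
         *-1-commutativeMonoid; *-assoc; *-distribˡ-+; *-distribʳ-+; *-identityˡ; *-identityʳ;
         *-zeroˡ; *-zeroʳ; fromℚᵘ-cong; toℚᵘ-cancel-<; toℚᵘ-fromℚᵘ; toℚᵘ-homo-+;
         toℚᵘ-homo-*; toℚᵘ-injective)
import Data.Rational.Unnormalised.Base as ℚᵘ
import Data.Rational.Unnormalised.Properties as ℚᵘ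
open import Data.Sum.Base using (_⊎_; inj₁; inj₂)
open import Data.Vec.Base as Vec using (Vec; []; _∷_; lookup)
open import Data.Vec.Properties as Vec using (lookup∘tabulate; tabulate∘lookup; tabulate-cong)
open import Data.Vec.Relation.Unary.Unique.Propositional using (Unique)
import Data.Vec.Relation.Unary.Unique.Propositional.Properties as Vec
open import Function.Base using (_∘_; const; id)
open import Function.Bundles using (mk⇔; module Equivalence)
open import Function.Definitions using (Injective)
open import Level using (Level)
open import Relation.Binary.Bundles using (DecTotalOrder)
open import Relation.Binary.Definitions using (DecidableEquality)
open import Relation.Binary.PropositionalEquality
open import Relation.Nullary.Decidable
  using (Dec; does; yes; no; dec-true; decidable-stable; ¬?; _×-dec_)
open import Relation.Nullary.Negation using (¬_; contradiction)
open import Relation.Unary using (Pred; Decidable)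
open import Defs
open Equivalence using (to; from)
open ≡-Reasoning

private
  module + = CommutativeSemigroupProperties
    (CommutativeMonoid.commutativeSemigroup +-0-commutativeMonoid)
  module * = CommutativeSemigroupProperties
    (CommutativeMonoid.commutativeSemigroup *-1-commutativeMonoid)

private variable
  a b ℓ : Level
  A : Set a
  B : Set b
  P : Set ℓ

-- Arithmetic of fractions in `ℚ`

/-≡-/ : ∀ i j m n → i ℤ.* + suc n ≡ j ℤ.* + suc m → i / suc m ≡ j / suc n
/-≡-/ i j m n eq = fromℚᵘ-cong {ℚᵘ.mkℚᵘ i m} {ℚᵘ.mkℚᵘ j n} (ℚᵘ.*≡* eq)

-- Addition in `ℚ` normalises its result; among unnormalised rationals the sum has this numerator
-- and denominator by definition, so the equation is proved there and carried back.
/-+-/ : ∀ i j m n →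
        i / suc m + j / suc n ≡ (i ℤ.* + suc n ℤ.+ j ℤ.* + suc m) / (suc m ℕ.* suc n)
/-+-/ i j m n = toℚᵘ-injective (ℚᵘ.≃-trans
  (toℚᵘ-homo-+ (fromℚᵘ p) (fromℚᵘ q)) (ℚᵘ.≃-trans
  (ℚᵘ.+-cong (toℚᵘ-fromℚᵘ p) (toℚᵘ-fromℚᵘ q))
  (ℚᵘ.≃-sym (toℚᵘ-fromℚᵘ (p ℚᵘ.+ q)))))
  where
  p = ℚᵘ.mkℚᵘ i m
  q = ℚᵘ.mkℚᵘ j n

/-*-/ : ∀ i j m n → (i / suc m) * (j / suc n) ≡ (i ℤ.* j) / (suc m ℕ.* suc n)
/-*-/ i j m n = toℚᵘ-injective (ℚᵘ.≃-trans
  (toℚᵘ-homo-* (fromℚᵘ p) (fromℚᵘ q)) (ℚᵘ.≃-trans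
  (ℚᵘ.*-cong (toℚᵘ-fromℚᵘ p) (toℚᵘ-fromℚᵘ q))
  (ℚᵘ.≃-sym (toℚᵘ-fromℚᵘ (p ℚᵘ.* q)))))
  where
  p = ℚᵘ.mkℚᵘ i m
  q = ℚᵘ.mkℚᵘ j n

1+n/1 : ∀ n → 1ℚ + + n / 1 ≡ + suc n / 1
1+n/1 n = trans (/-+-/ 1ℤ (+ n) 0 0)
  (/-≡-/ (1ℤ ℤ.* 1ℤ ℤ.+ + n ℤ.* 1ℤ) (+ suc n) 0 0 (1+ (+ n)))
  where
  1+ : ∀ i → (1ℤ ℤ.* 1ℤ ℤ.+ i ℤ.* 1ℤ) ℤ.* 1ℤ ≡ (1ℤ ℤ.+ i) ℤ.* 1ℤ
  1+ = ℤ.solve-∀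

1/n*n≡1 : ∀ n → (1ℤ / suc n) * (+ suc n / 1) ≡ 1ℚ
1/n*n≡1 n = trans (/-*-/ 1ℤ (+ suc n) n 0)
  (/-≡-/ (1ℤ ℤ.* + suc n) 1ℤ (n ℕ.* 1) 0 (cancel (+ suc n)))
  where
  cancel : ∀ i → (1ℤ ℤ.* i) ℤ.* 1ℤ ≡ 1ℤ ℤ.* (i ℤ.* 1ℤ)
  cancel = ℤ.solve-∀

-- The pairing of arrival orders determines twice the success probability; this recovers the
-- probability itself.
p+p≡q+q⇒p≡q : ∀ {p q} → p + p ≡ q + q → p ≡ q
p+p≡q+q⇒p≡q {p} {q} eq = trans (sym (halve p)) (trans (cong (λ s → ½ * s) eq) (halve q))
  where
  halve : ∀ p → ½ * (p + p) ≡ p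
  halve p = begin
    ½ * (p + p)    ≡⟨ *-distribˡ-+ ½ p p ⟩
    ½ * p + ½ * p  ≡⟨ *-distribʳ-+ p ½ ½ ⟨
    1ℚ * p         ≡⟨ *-identityˡ p ⟩
    p              ∎

-- Finite sums

∑ : List A → (A → ℚ) → ℚ
∑ xs f = foldr _+_ 0ℚ (map f xs)

∑-cong : ∀ (xs : List A) {f g} → (∀ {x} → x ∈ xs → f x ≡ g x) → ∑ xs f ≡ ∑ xs g
∑-cong []       f≗g = refl
∑-cong (x ∷ xs) f≗g = cong₂ _+_ (f≗g (here refl)) (∑-cong xs (f≗g ∘ there))

∑-map : ∀ xs (f : A → B) g → ∑ (map f xs) g ≡ ∑ xs (g ∘ f)
∑-map []       f g = refl
∑-map (x ∷ xs) f g = cong (λ s → g (f x) + s) (∑-map xs f g)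

∑-zero : ∀ (xs : List A) → ∑ xs (const 0ℚ) ≡ 0ℚ
∑-zero []       = refl
∑-zero (x ∷ xs) = trans (+-identityˡ (∑ xs (const 0ℚ))) (∑-zero xs)

∑-+ : ∀ (xs : List A) f g → ∑ xs (λ x → f x + g x) ≡ ∑ xs f + ∑ xs g
∑-+ []       f g = refl
∑-+ (x ∷ xs) f g = trans
  (cong (λ s → f x + g x + s) (∑-+ xs f g))
  (+.interchange (f x) (g x) (∑ xs f) (∑ xs g))

∑-*ˡ : ∀ (xs : List A) c f → ∑ xs (λ x → c * f x) ≡ c * ∑ xs f
∑-*ˡ []       c f = sym (*-zeroʳ c)
∑-*ˡ (x ∷ xs) c f = trans
  (cong (λ s → c * f x + s) (∑-*ˡ xs c f))
  (sym (*-distribˡ-+ c (f x) (∑ xs f)))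

∑-swap : ∀ (xs : List A) (ys : List B) (f : A → B → ℚ) →
         ∑ xs (λ x → ∑ ys (f x)) ≡ ∑ ys (λ y → ∑ xs (λ x → f x y))
∑-swap []       ys f = sym (∑-zero ys)
∑-swap (x ∷ xs) ys f = trans
  (cong (λ s → ∑ ys (f x) + s) (∑-swap xs ys f))
  (sym (∑-+ ys (f x) (λ y → ∑ xs (λ x → f x y))))

∑-const : ∀ (xs : List A) c → ∑ xs (const c) ≡ (+ length xs / 1) * c
∑-const []       c = sym (*-zeroˡ c)
∑-const (x ∷ xs) c = begin
  c + ∑ xs (const c)              ≡⟨ cong₂ _+_ (*-identityˡ c) (sym (∑-const xs c)) ⟨
  1ℚ * c + (+ length xs / 1) * c  ≡⟨ *-distribʳ-+ c 1ℚ (+ length xs / 1) ⟨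
  (1ℚ + + length xs / 1) * c      ≡⟨ cong (_* c) (1+n/1 (length xs)) ⟩
  (+ suc (length xs) / 1) * c     ∎

∑-↭ : ∀ {xs ys : List A} f → xs ↭ ys → ∑ xs f ≡ ∑ ys f
∑-↭ f xs↭ys = Permutation.foldr-commMonoid (setoid ℚ) +-0-isCommutativeMonoid
  (↭⇒↭ₛ (↭.map⁺ f xs↭ys))

-- Indicators of decidable propositions

indicator : Dec P → ℚ
indicator P? = if does P? then 1ℚ else 0ℚ

indicator-yes : (P? : Dec P) → P → indicator P? ≡ 1ℚ
indicator-yes (yes _) _ = refl
indicator-yes (no ¬p) p = contradiction p ¬p

indicator-no : (P? : Dec P) → ¬ P → indicator P? ≡ 0ℚ
indicator-no (yes p) ¬p = contradiction p ¬p
indicator-no (no _)  _  = refl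

indicator-⇔ : ∀ {q} {Q : Set q} (P? : Dec P) (Q? : Dec Q) → (P → Q) → (Q → P) →
              indicator P? ≡ indicator Q?
indicator-⇔ P? (yes q) _   Q⇒P = indicator-yes P? (Q⇒P q)
indicator-⇔ P? (no ¬q) P⇒Q _   = indicator-no P? (¬q ∘ P⇒Q)

module _ {q} {Q : Set q} (P? : Dec P) (Q? : Dec Q) where

  indicator-+-yes-yes : P → Q → indicator P? + indicator Q? ≡ 1ℚ + 1ℚ
  indicator-+-yes-yes p q = cong₂ _+_ (indicator-yes P? p) (indicator-yes Q? q)

  indicator-+-yes-no : P → ¬ Q → indicator P? + indicator Q? ≡ 1ℚ
  indicator-+-yes-no p ¬q = cong₂ _+_ (indicator-yes P? p) (indicator-no Q? ¬q)

  indicator-+-no-yes : ¬ P → Q → indicator P? + indicator Q? ≡ 1ℚ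
  indicator-+-no-yes ¬p q = cong₂ _+_ (indicator-no P? ¬p) (indicator-yes Q? q)

∑-indicator-≡ : (_≟_ : DecidableEquality A) → ∀ {xs y} → List.Unique xs → y ∈ xs →
                ∑ xs (λ x → indicator (y ≟ x)) ≡ 1ℚ
∑-indicator-≡ _≟_ {x ∷ xs} {y} (x∉xs ∷ _) (here refl) = cong₂ _+_
  (indicator-yes (y ≟ y) refl)
  (trans (∑-cong xs (λ {z} z∈xs → indicator-no (y ≟ z) (All.lookup x∉xs z∈xs)))
         (∑-zero xs))
∑-indicator-≡ _≟_ {x ∷ xs} {y} (x∉xs ∷ xs!) (there y∈xs) = cong₂ _+_
  (indicator-no (y ≟ x) (All.lookup x∉xs y∈xs ∘ sym))
  (∑-indicator-≡ _≟_ xs! y∈xs)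

-- Injectivity is asked for on the entries only, since the reversal of arrival orders used later is
-- known to be an involution only on `arrivalOrders`.
Unique-map⁺ : ∀ {f : A → B} {xs} →
              (∀ {x y} → x ∈ xs → y ∈ xs → f x ≡ f y → x ≡ y) →
              List.Unique xs → List.Unique (map f xs)
Unique-map⁺ inj []           = []
Unique-map⁺ inj (x∉xs ∷ xs!) =
  All.map⁺ (All.tabulate λ y∈xs fx≡fy →
    All.lookup x∉xs y∈xs (inj (here refl) (there y∈xs) fx≡fy)) ∷
  Unique-map⁺ (λ x∈ y∈ → inj (there x∈) (there y∈)) xs!

module _ {f : A → A} {xs : List A} (xs! : List.Unique xs)
         (closed : ∀ {x} → x ∈ xs → f x ∈ xs)
         (involutive : ∀ {x} → x ∈ xs → f (f x) ≡ x) where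

  -- Both lists are duplicate-free and have the same members, each `y` being the image of `f y`. For
  -- duplicate-free lists, equality as sets is equality as bags.
  map-involution-↭ : map f xs ↭ xs
  map-involution-↭ = ∼bag⇒↭ (unique∧set⇒bag fxs! xs! (mk⇔ map⊆ ⊆map))
    where
    fxs! : List.Unique (map f xs)
    fxs! = Unique-map⁺
      (λ x∈ y∈ fx≡fy → trans (sym (involutive x∈)) (trans (cong f fx≡fy) (involutive y∈))) xs!
    map⊆ : ∀ {y} → y ∈ map f xs → y ∈ xs
    map⊆ y∈ with _ , x∈xs , refl ← ∈-map⁻ f y∈ = closed x∈xs
    ⊆map : ∀ {y} → y ∈ xs → y ∈ map f xs
    ⊆map y∈ = subst (_∈ map f xs) (involutive y∈) (∈-map⁺ f (closed y∈))

  ∑-involution : ∀ g → ∑ xs (g ∘ f) ≡ ∑ xs g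
  ∑-involution g = trans (sym (∑-map xs f g)) (∑-↭ g map-involution-↭)

-- Means and probabilities

-- Zero on the empty list, where uniform has total mass 0.
weight : List A → ℚ
weight []       = 0ℚ
weight (_ ∷ xs) = 1ℤ / suc (length xs)

mean : List A → (A → ℚ) → ℚ
mean xs f = weight xs * ∑ xs f

mean-cong : ∀ (xs : List A) {f g} → (∀ {x} → x ∈ xs → f x ≡ g x) → mean xs f ≡ mean xs g
mean-cong xs f≗g = cong (λ s → weight xs * s) (∑-cong xs f≗g)

mean-+ : ∀ (xs : List A) f g → mean xs (λ x → f x + g x) ≡ mean xs f + mean xs g
mean-+ xs f g = trans
  (cong (λ s → weight xs * s) (∑-+ xs f g))
  (*-distribˡ-+ (weight xs) (∑ xs f) (∑ xs g))

mean-involution : ∀ {f : A → A} {xs} → List.Unique xs → (∀ {x} → x ∈ xs → f x ∈ xs) →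
                  (∀ {x} → x ∈ xs → f (f x) ≡ x) → ∀ g → mean xs (g ∘ f) ≡ mean xs g
mean-involution {xs = xs} xs! closed involutive g =
  cong (λ s → weight xs * s) (∑-involution xs! closed involutive g)

-- The membership excludes the empty list, whose mean is always 0.
mean-const : ∀ {xs : List A} {x} → x ∈ xs → ∀ c → mean xs (const c) ≡ c
mean-const {xs = xs@(_ ∷ ys)} _ c = begin
  weight xs * ∑ xs (const c)           ≡⟨ cong (λ s → weight xs * s) (∑-const xs c) ⟩
  weight xs * ((+ length xs / 1) * c)  ≡⟨ *-assoc (weight xs) (+ length xs / 1) c ⟨
  weight xs * (+ length xs / 1) * c    ≡⟨ cong (_* c) (1/n*n≡1 (length ys)) ⟩
  1ℚ * c                               ≡⟨ *-identityˡ c ⟩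
  c                                    ∎

mean-swap : ∀ (xs : List A) (ys : List B) (f : A → B → ℚ) →
            mean xs (λ x → mean ys (f x)) ≡ mean ys (λ y → mean xs (λ x → f x y))
mean-swap xs ys f = begin
  w * ∑ xs (λ x → v * ∑ ys (f x))            ≡⟨ cong (λ s → w * s) (∑-*ˡ xs v (λ x → ∑ ys (f x))) ⟩
  w * (v * ∑ xs (λ x → ∑ ys (f x)))          ≡⟨ *.x∙yz≈y∙xz w v (∑ xs (λ x → ∑ ys (f x))) ⟩
  v * (w * ∑ xs (λ x → ∑ ys (f x)))          ≡⟨ cong (λ s → v * (w * s)) (∑-swap xs ys f) ⟩
  v * (w * ∑ ys (λ y → ∑ xs (λ x → f x y)))  ≡⟨ cong (λ s → v * s) (∑-*ˡ ys w (λ y → ∑ xs (λ x → f x y))) ⟨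
  v * ∑ ys (λ y → w * ∑ xs (λ x → f x y))    ∎
  where
  w = weight xs
  v = weight ys

module _ {q} {P : Pred B q} (P? : Decidable P) where

  Pr-++ : ∀ d e → Pr (d ++ e) P? ≡ Pr d P? + Pr e P?
  Pr-++ []            e = sym (+-identityˡ (Pr e P?))
  Pr-++ ((x , p) ∷ d) e with P? x
  ... | yes _ = trans (cong (λ s → p + s) (Pr-++ d e)) (sym (+-assoc p (Pr d P?) (Pr e P?)))
  ... | no  _ = Pr-++ d e

  Pr-scale : ∀ p d → Pr (map (λ (y , q) → y , p * q) d) P? ≡ p * Pr d P?
  Pr-scale p []            = sym (*-zeroʳ p)
  Pr-scale p ((y , q) ∷ d) with P? y
  ... | yes _ = trans (cong (λ s → p * q + s) (Pr-scale p d)) (sym (*-distribˡ-+ p q (Pr d P?)))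
  ... | no  _ = Pr-scale p d

  Pr->>= : ∀ (d : Dist A) (f : A → Dist B) →
           Pr (d >>= f) P? ≡ ∑ d (λ (x , p) → p * Pr (f x) P?)
  Pr->>= []            f = refl
  Pr->>= ((x , p) ∷ d) f = trans
    (Pr-++ (map (λ (y , q) → y , p * q) (f x)) (d >>= f))
    (cong₂ _+_ (Pr-scale p (f x)) (Pr->>= d f))

  Pr-uniform->>= : ∀ (xs : List A) (f : A → Dist B) →
                   Pr (uniform xs >>= f) P? ≡ mean xs (λ x → Pr (f x) P?)
  Pr-uniform->>= []         f = refl
  Pr-uniform->>= xs@(_ ∷ _) f = begin
    Pr (uniform xs >>= f) P?                      ≡⟨ Pr->>= (uniform xs) f ⟩
    ∑ (uniform xs) (λ (x , p) → p * Pr (f x) P?)  ≡⟨ ∑-map xs (_, weight xs) (λ (x , p) → p * Pr (f x) P?) ⟩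
    ∑ xs (λ x → weight xs * Pr (f x) P?)          ≡⟨ ∑-*ˡ xs (weight xs) (λ x → Pr (f x) P?) ⟩
    mean xs (λ x → Pr (f x) P?)                   ∎

  Pr-pure : ∀ x → Pr (pure x) P? ≡ indicator (P? x)
  Pr-pure x with P? x
  ... | yes _ = refl
  ... | no  _ = refl

  -- This is the shape of `experiment`: an arrival order, then a signal time whose range depends on
  -- it.
  Pr-uniform-uniform : ∀ {c} {C : Set c} (xs : List A) (ys : A → List C) (g : A → C → B) →
    Pr (uniform xs >>= λ x → uniform (ys x) >>= λ y → pure (g x y)) P? ≡
    mean xs (λ x → mean (ys x) (λ y → indicator (P? (g x y))))
  Pr-uniform-uniform xs ys g = trans
    (Pr-uniform->>= xs (λ x → uniform (ys x) >>= λ y → pure (g x y)))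
    (mean-cong xs λ {x} _ → trans
      (Pr-uniform->>= (ys x) (λ y → pure (g x y)))
      (mean-cong (ys x) λ {y} _ → Pr-pure (g x y)))

-- Reversal of an initial segment of times

m∸1+[m∸1+n]≡n : ∀ {m n} → n < m → m ∸ suc (m ∸ suc n) ≡ n
m∸1+[m∸1+n]≡n (s≤s n≤m) = ℕ.m∸[m∸n]≡n n≤m

m∸1+n<m : ∀ {m n} → n < m → m ∸ suc n < m
m∸1+n<m {suc m} {n} _ = s≤s (ℕ.m∸n≤m m n)

module _ {n} (m : ℕ) .(m≤n : m ≤ n) where

  reversePrefix : Fin n → Fin n
  reversePrefix t with toℕ t ℕ.<? m
  ... | yes t<m = fromℕ< (ℕ.<-≤-trans (m∸1+n<m t<m) m≤n)
  ... | no  _   = t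

  toℕ-reversePrefix : ∀ {t} → toℕ t < m → toℕ (reversePrefix t) ≡ m ∸ suc (toℕ t)
  toℕ-reversePrefix {t} t<m with toℕ t ℕ.<? m
  ... | yes _   = Fin.toℕ-fromℕ< _
  ... | no  t≮m = contradiction t<m t≮m

  reversePrefix-< : ∀ {t} → toℕ t < m → toℕ (reversePrefix t) < m
  reversePrefix-< t<m rewrite toℕ-reversePrefix t<m = m∸1+n<m t<m

  reversePrefix-≥ : ∀ {t} → m ≤ toℕ t → reversePrefix t ≡ t
  reversePrefix-≥ {t} m≤t with toℕ t ℕ.<? m
  ... | yes t<m = contradiction t<m (ℕ.≤⇒≯ m≤t)
  ... | no  _   = refl

  reversePrefix-involutive : ∀ t → reversePrefix (reversePrefix t) ≡ t
  reversePrefix-involutive t = by-cases (toℕ t ℕ.<? m)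
    where
    by-cases : Dec (toℕ t < m) → reversePrefix (reversePrefix t) ≡ t
    by-cases (yes t<m) = Fin.toℕ-injective (begin
      toℕ (reversePrefix (reversePrefix t))  ≡⟨ toℕ-reversePrefix (reversePrefix-< t<m) ⟩
      m ∸ suc (toℕ (reversePrefix t))        ≡⟨ cong (λ k → m ∸ suc k) (toℕ-reversePrefix t<m) ⟩
      m ∸ suc (m ∸ suc (toℕ t))              ≡⟨ m∸1+[m∸1+n]≡n t<m ⟩
      toℕ t                                  ∎)
    by-cases (no t≮m) = trans (cong reversePrefix fixed) fixed
      where fixed = reversePrefix-≥ (ℕ.≮⇒≥ t≮m)

-- The first acts on the items, leaving the best one at `i` and sending a time `j < i` to
-- `i - 1 - j`. The second acts on the signal time, which may equal `i`, and sends `s` to `i - s`.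
-- This offset by one is what makes success and failure change places.
reverseBefore reverseUpTo : ∀ {n} → Fin n → Fin n → Fin n
reverseBefore i = reversePrefix (toℕ i) (Fin.toℕ≤n i)
reverseUpTo   i = reversePrefix (suc (toℕ i)) (Fin.toℕ<n i)

reverseBefore-involutive : ∀ {n} (i t : Fin n) → reverseBefore i (reverseBefore i t) ≡ t
reverseBefore-involutive i = reversePrefix-involutive (toℕ i) (Fin.toℕ≤n i)

reverseUpTo-involutive : ∀ {n} (i t : Fin n) → reverseUpTo i (reverseUpTo i t) ≡ t
reverseUpTo-involutive i = reversePrefix-involutive (suc (toℕ i)) (Fin.toℕ<n i)

reverseBefore-fixed : ∀ {n} (i : Fin n) → reverseBefore i i ≡ i
reverseBefore-fixed i = reversePrefix-≥ (toℕ i) (Fin.toℕ≤n i) ℕ.≤-refl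

signalTimes : ∀ {n} → Fin n → List (Fin n)
signalTimes i = filter (Fin._≤? i) (allFin _)

-- Substituting `i - s` for `s` permutes the signal times, so it preserves the mean of `g` and the
-- two means can be added term by term.
mean-signalTimes-pairing : ∀ {n} (i : Fin n) f g {c} →
  (∀ {s} → toℕ s ≤ toℕ i → f s + g (reverseUpTo i s) ≡ c) →
  mean (signalTimes i) f + mean (signalTimes i) g ≡ c
mean-signalTimes-pairing {n} i f g {c} pairing = begin
  mean S f + mean S g          ≡⟨ cong (λ m → mean S f + m)
                                    (mean-involution S-unique closed (λ _ → ττ _) g) ⟨
  mean S f + mean S (g ∘ τ)    ≡⟨ mean-+ S f (g ∘ τ) ⟨
  mean S (λ s → f s + g (τ s)) ≡⟨ mean-cong S (λ s∈ → pairing (s≤i s∈)) ⟩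
  mean S (λ _ → c)             ≡⟨ mean-const (∈-filter⁺ (Fin._≤? i) (∈-allFin i) ℕ.≤-refl) c ⟩
  c                            ∎
  where
  S = signalTimes i
  τ = reverseUpTo i
  ττ = reverseUpTo-involutive i
  S-unique = List.filter⁺ (Fin._≤? i) (List.allFin⁺ n)
  s≤i : ∀ {s} → s ∈ S → toℕ s ≤ toℕ i
  s≤i s∈ = proj₂ (∈-filter⁻ (Fin._≤? i) {xs = allFin n} s∈)
  closed : ∀ {s} → s ∈ S → τ s ∈ S
  -- The bound `s ≤ i` is read as `s < i + 1`, the length of the reversed prefix.
  closed s∈ = ∈-filter⁺ (Fin._≤? i) (∈-allFin _)
    (ℕ.s≤s⁻¹ (reversePrefix-< (suc (toℕ i)) (Fin.toℕ<n i) (s≤s (s≤i s∈))))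

-- Uniformity of the best time

allVecs-complete : ∀ {xs : List A} → (∀ x → x ∈ xs) → ∀ {k} (v : Vec A k) → v ∈ allVecs xs k
allVecs-complete x∈xs []      = here refl
allVecs-complete x∈xs (x ∷ v) = ∈-cartesianProductWith⁺ _∷_ (x∈xs x) (allVecs-complete x∈xs v)

allVecs-unique : ∀ {xs : List A} → List.Unique xs → ∀ k → List.Unique (allVecs xs k)
allVecs-unique xs! zero    = [] ∷ []
allVecs-unique xs! (suc k) =
  List.cartesianProductWith⁺ _∷_ Vec.∷-injective xs! (allVecs-unique xs! k)

arrivalOrders-unique : ∀ n → List.Unique (arrivalOrders n)
arrivalOrders-unique n = List.filter⁺ unique? (allVecs-unique (List.allFin⁺ n) n)

∈-arrivalOrders⁺ : ∀ {n} {σ : Vec (Fin n) n} → Unique σ → σ ∈ arrivalOrders n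
∈-arrivalOrders⁺ = ∈-filter⁺ unique? (allVecs-complete ∈-allFin _)

∈-arrivalOrders⁻ : ∀ {n} {σ : Vec (Fin n) n} → σ ∈ arrivalOrders n → Unique σ
∈-arrivalOrders⁻ {n} = proj₂ ∘ ∈-filter⁻ unique? {xs = allVecs (allFin n) n}

permute : ∀ {n} → (Fin n → Fin n) → Vec A n → Vec A n
permute ρ σ = Vec.tabulate (lookup σ ∘ ρ)

module _ {n} (ρ : Fin n → Fin n) (ρ-involutive : ∀ t → ρ (ρ t) ≡ t) where

  permute-involutive : ∀ (σ : Vec A n) → permute ρ (permute ρ σ) ≡ σ
  permute-involutive σ = trans
    (tabulate-cong λ t →
      trans (lookup∘tabulate (lookup σ ∘ ρ) (ρ t)) (cong (lookup σ) (ρ-involutive t)))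
    (tabulate∘lookup σ)

  -- An involution is injective, so distinct times still receive distinct items.
  permute-∈-arrivalOrders : ∀ {σ} → σ ∈ arrivalOrders n → permute ρ σ ∈ arrivalOrders n
  permute-∈-arrivalOrders σ∈ = ∈-arrivalOrders⁺ (Vec.tabulate⁺ λ {i} {j} eq →
    trans (sym (ρ-involutive i))
      (trans (cong ρ (Vec.lookup-injective (∈-arrivalOrders⁻ σ∈) _ _ eq)) (ρ-involutive j)))

-- The averaging arguments use only that `best` moves along with the times under every involution,
-- so it is kept abstract.
module _ {n} (best : Vec (Fin (suc n)) (suc n) → Fin (suc n))
         (best-permute : ∀ (ρ : Fin (suc n) → Fin (suc n)) → (∀ t → ρ (ρ t) ≡ t) →
           ∀ {σ} → σ ∈ arrivalOrders (suc n) → best (permute ρ σ) ≡ ρ (best σ)) where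

  private orders = arrivalOrders (suc n)

  -- The identity order serves as the witness of nonemptiness for `mean-const`.
  some-order : Vec.tabulate id ∈ orders
  some-order = ∈-arrivalOrders⁺ (Vec.tabulate⁺ id)

  bestFirst : ℚ
  bestFirst = mean orders (λ σ → indicator (best σ Fin.≟ zero))

  -- Swapping times 0 and k carries the orders with best time k to those with best time 0;
  -- reversing the first k + 1 times is one way to do it.
  best-uniform : ∀ k → mean orders (λ σ → indicator (best σ Fin.≟ k)) ≡ bestFirst
  best-uniform k = begin
    mean orders (λ σ → indicator (best σ Fin.≟ k))
      ≡⟨ mean-cong orders (λ {σ} σ∈ → indicator-⇔ (best σ Fin.≟ k) (best (permute ρ σ) Fin.≟ zero)
           (λ eq → trans (best-permute ρ ρρ σ∈) (trans (cong ρ eq) ρk≡0))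
           (λ eq → trans (sym (ρρ (best σ)))
              (trans (cong ρ (trans (sym (best-permute ρ ρρ σ∈)) (trans eq (sym ρk≡0)))) (ρρ k)))) ⟩
    mean orders (λ σ → indicator (best (permute ρ σ) Fin.≟ zero))
      ≡⟨ mean-involution (arrivalOrders-unique (suc n)) (permute-∈-arrivalOrders ρ ρρ)
           (λ {σ} _ → permute-involutive ρ ρρ σ) (λ σ → indicator (best σ Fin.≟ zero)) ⟩
    bestFirst  ∎
    where
    ρ = reverseUpTo k
    ρρ = reverseUpTo-involutive k
    ρk≡0 : ρ k ≡ zero
    ρk≡0 = Fin.toℕ-injective
      (trans (toℕ-reversePrefix (suc (toℕ k)) (Fin.toℕ<n k) ℕ.≤-refl) (ℕ.n∸n≡0 (toℕ k)))

  -- Double counting: all `k` are equally likely to be the best time, so `bestFirst` is the average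
  -- of these probabilities over `k`. Interchanging the means, each order contributes exactly one
  -- hit among the `n + 1` times.
  bestFirst≡1/n : bestFirst ≡ 1ℤ / suc n
  bestFirst≡1/n = begin
    bestFirst
      ≡⟨ mean-const (∈-allFin {suc n} zero) bestFirst ⟨
    mean times (const bestFirst)
      ≡⟨ mean-cong times (λ {k} _ → best-uniform k) ⟨
    mean times (λ k → mean orders (λ σ → indicator (best σ Fin.≟ k)))
      ≡⟨ mean-swap times orders (λ k σ → indicator (best σ Fin.≟ k)) ⟩
    mean orders (λ σ → mean times (λ k → indicator (best σ Fin.≟ k)))
      ≡⟨ mean-cong orders (λ {σ} _ → cong (λ s → weight times * s)
           (∑-indicator-≡ Fin._≟_ (List.allFin⁺ (suc n)) (∈-allFin (best σ)))) ⟩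
    mean orders (const (weight times * 1ℚ))
      ≡⟨ mean-const some-order (weight times * 1ℚ) ⟩
    weight times * 1ℚ
      ≡⟨ *-identityʳ (weight times) ⟩
    weight times
      ≡⟨ cong (λ m → 1ℤ / suc m) (length-tabulate {n = n} suc) ⟩
    1ℤ / suc n  ∎
    where times = allFin (suc n)

  -- The prefix to be reversed depends on the order, but `φ` keeps the best time and therefore is
  -- still an involution. So `f` and `f ∘ φ` have the same mean, and the extra 1 at best time 0
  -- contributes the probability of that event.
  mean-reverseBefore : ∀ (f : Vec (Fin (suc n)) (suc n) → ℚ) →
    (∀ {σ} → σ ∈ orders →
      f σ + f (permute (reverseBefore (best σ)) σ) ≡ 1ℚ + indicator (best σ Fin.≟ zero)) →
    mean orders f + mean orders f ≡ 1ℚ + 1ℤ / suc n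
  mean-reverseBefore f pairing = begin
    mean orders f + mean orders f
      ≡⟨ cong (λ m → mean orders f + m)
           (mean-involution (arrivalOrders-unique (suc n)) closed involutive f) ⟨
    mean orders f + mean orders (f ∘ φ)
      ≡⟨ mean-+ orders f (f ∘ φ) ⟨
    mean orders (λ σ → f σ + f (φ σ))
      ≡⟨ mean-cong orders pairing ⟩
    mean orders (λ σ → 1ℚ + indicator (best σ Fin.≟ zero))
      ≡⟨ mean-+ orders (const 1ℚ) (λ σ → indicator (best σ Fin.≟ zero)) ⟩
    mean orders (const 1ℚ) + bestFirst
      ≡⟨ cong₂ _+_ (mean-const some-order 1ℚ) bestFirst≡1/n ⟩
    1ℚ + 1ℤ / suc n  ∎
    where
    φ : Vec (Fin (suc n)) (suc n) → Vec (Fin (suc n)) (suc n)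
    φ σ = permute (reverseBefore (best σ)) σ
    closed : ∀ {σ} → σ ∈ orders → φ σ ∈ orders
    closed {σ} = permute-∈-arrivalOrders (reverseBefore (best σ)) (reverseBefore-involutive (best σ))
    best-φ : ∀ {σ} → σ ∈ orders → best (φ σ) ≡ best σ
    best-φ {σ} σ∈ = trans
      (best-permute (reverseBefore (best σ)) (reverseBefore-involutive (best σ)) σ∈)
      (reverseBefore-fixed (best σ))
    involutive : ∀ {σ} → σ ∈ orders → φ (φ σ) ≡ σ
    -- The second reversal is governed by `best (φ σ)`, which must first be identified with
    -- `best σ`.
    involutive {σ} σ∈ = trans
      (cong (λ i → permute (reverseBefore i) (φ σ)) (best-φ σ∈))
      (permute-involutive (reverseBefore (best σ)) (reverseBefore-involutive (best σ)) σ)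

-- Searching through finite sequences

any-take-tabulate⁺ : ∀ {n} (p : A → Bool) (f : Fin n → A) {t u : Fin n} → toℕ u < toℕ t →
                     T (p (f u)) → T (any p (take (toℕ t) (tabulate f)))
any-take-tabulate⁺ p f {suc t} {zero}  _         pfu = from T-∨ (inj₁ pfu)
any-take-tabulate⁺ p f {suc t} {suc u} (s≤s u<t) pfu =
  from (T-∨ {p (f zero)}) (inj₂ (any-take-tabulate⁺ p (f ∘ suc) u<t pfu))

any-take-tabulate⁻ : ∀ {n} (p : A → Bool) (f : Fin n → A) (t : Fin n) →
                     T (any p (take (toℕ t) (tabulate f))) →
                     ∃[ u ] toℕ u < toℕ t × T (p (f u))
any-take-tabulate⁻ p f (suc t) h with to (T-∨ {p (f zero)}) h
... | inj₁ pf0 = zero , z<s , pf0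
... | inj₂ h′  with u , u<t , pfu ← any-take-tabulate⁻ p (f ∘ suc) t h′ =
  suc u , s<s u<t , pfu

-- That the first hit is minimal is expressed by bounding it by an arbitrary hit `t`; the last
-- component identifies the results for different `t`.
findᵇ-tabulate : ∀ {n} (p : A → Bool) (f : Fin n → A) t → T (p (f t)) →
                 ∃[ u ] toℕ u ≤ toℕ t × T (p (f u)) × findᵇ p (tabulate f) ≡ just (f u)
findᵇ-tabulate {n = suc n} p f t pft with p (f zero) in eq
... | true = zero , z≤n , subst T (sym eq) _ , refl
findᵇ-tabulate {n = suc n} p f zero pft | false = contradiction (subst T eq pft) id
findᵇ-tabulate {n = suc n} p f (suc t) pft | false
  with u , u≤t , pfu , found ← findᵇ-tabulate p (f ∘ suc) t pft = suc u , s≤s u≤t , pfu , found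

T-does⁺ : (P? : Dec P) → P → T (does P?)
T-does⁺ P? = from T-≡ ∘ dec-true P?

T-does⁻ : (P? : Dec P) → T (does P?) → P
T-does⁻ (yes p) _ = p

module _ {p} {P : Pred A p} (P? : Decidable P) {xs : List A} where

  -- As `rank` is a successor, the test `rank ≡ᵇ 1` computes to such a test on the number of better
  -- earlier items.
  length-filter≡ᵇ0⁺ : (∀ {x} → x ∈ xs → ¬ P x) → T (length (filter P? xs) ≡ᵇ 0)
  length-filter≡ᵇ0⁺ none rewrite filter-none P? {xs} (All.tabulate none) = _

  length-filter≡ᵇ0⁻ : T (length (filter P? xs) ≡ᵇ 0) → ∀ {x} → x ∈ xs → ¬ P x
  -- The membership rules out an empty filtered list; for a nonempty one, `h` is already a proof of
  -- falsity.
  length-filter≡ᵇ0⁻ h x∈xs px with filter P? xs | ∈-filter⁺ P? x∈xs px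
  ... | _ ∷ _ | _ = h

-- The secretary problem

module _ {c ℓ₁ ℓ₂} (O : DecTotalOrder c ℓ₁ ℓ₂) where

  open DecTotalOrder O using (_≈_; _≤?_; antisym; totalOrder)
    renaming (Carrier to Value; _≤_ to _≼_)
  open Extrema totalOrder using (argmax; argmax-all; f[xs]≤f[argmax])
  open Secretary O

  -- Records and the stopping rule of `𝒜`

  IsRecord : ∀ {n} → (Fin n → Value) → Fin n → Set ℓ₂
  IsRecord x t = ∀ u → toℕ u < toℕ t → x u ≼ x t

  module _ {n} (x : Fin n → Value) where

    rank≡ᵇ1⇒IsRecord : ∀ t → T (rank x t ≡ᵇ 1) → IsRecord x t
    rank≡ᵇ1⇒IsRecord t h u u<t = decidable-stable (x u ≤? x t) λ xu⋠xt →
      length-filter≡ᵇ0⁻ (λ u → (u Fin.<? t) ×-dec ¬? (x u ≤? x t)) h (∈-allFin u) (u<t , xu⋠xt)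

    IsRecord⇒rank≡ᵇ1 : ∀ t → IsRecord x t → T (rank x t ≡ᵇ 1)
    IsRecord⇒rank≡ᵇ1 t record-t =
      length-filter≡ᵇ0⁺ (λ u → (u Fin.<? t) ×-dec ¬? (x u ≤? x t)) {allFin n}
        λ {u} _ (u<t , xu⋠xt) → xu⋠xt (record-t u u<t)

    module _ (s : Fin n) where

      past : Fin n → List Observation
      past t = take (toℕ t) (tabulate (observe x s))

      stops : Fin n → Bool
      stops t = 𝒜 (past t) (observe x s t)

      -- `𝒜` recognises `s ≤ t` from its observations: a signal before `t` lies in `past t`, and one
      -- at `t` in the present observation.
      stops⁺ : ∀ {t} → toℕ s ≤ toℕ t → IsRecord x t → T (stops t)
      stops⁺ {t} s≤t record-t = from T-∧ (signalled , IsRecord⇒rank≡ᵇ1 t record-t)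
        where
        signalled : T (any signal (past t) ∨ does (s Fin.≟ t))
        signalled with ℕ.m≤n⇒m<n∨m≡n s≤t
        ... | inj₁ s<t = from (T-∨ {any signal (past t)}) (inj₁
          (any-take-tabulate⁺ signal (observe x s) s<t (T-does⁺ (s Fin.≟ s) refl)))
        ... | inj₂ s≡t = from (T-∨ {any signal (past t)}) (inj₂
          (T-does⁺ (s Fin.≟ t) (Fin.toℕ-injective s≡t)))

      stops⁻ : ∀ t → T (stops t) → toℕ s ≤ toℕ t × IsRecord x t
      stops⁻ t h
        with signalled , rank≡1 ← to (T-∧ {any signal (past t) ∨ does (s Fin.≟ t)}) h
        = s≤t (to (T-∨ {any signal (past t)}) signalled) , rank≡ᵇ1⇒IsRecord t rank≡1
        where
        s≤t : T (any signal (past t)) ⊎ T (does (s Fin.≟ t)) → toℕ s ≤ toℕ t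
        s≤t (inj₁ earlier) with u , u<t , s≟u ← any-take-tabulate⁻ signal (observe x s) t earlier
                           with refl ← T-does⁻ (s Fin.≟ u) s≟u = ℕ.<⇒≤ u<t
        s≤t (inj₂ now)     with refl ← T-does⁻ (s Fin.≟ t) now = ℕ.≤-refl

  -- The best item overall and the best item before a given time

  IsBest : ∀ {n} → (Fin n → Value) → Fin n → Set ℓ₂
  IsBest x i = ∀ u → x u ≼ x i

  bestTime-isBest : ∀ {n} (x : Fin (suc n) → Value) → IsBest x (bestTime x)
  bestTime-isBest x u = All.lookup (f[xs]≤f[argmax] {f = x} zero (allFin _)) (∈-allFin u)

  isBest-∘ : ∀ {n} {x y : Fin n → Value} (ρ : Fin n → Fin n) → (∀ t → ρ (ρ t) ≡ t) →
             y ≗ x ∘ ρ → ∀ {i} → IsBest x i → IsBest y (ρ i)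
  isBest-∘ {x = x} {y} ρ ρρ y≗xρ {i} best u =
    subst₂ _≼_ (sym (y≗xρ u)) (sym (trans (y≗xρ (ρ i)) (cong x (ρρ i)))) (best (ρ u))

  isBest-unique : ∀ {n} {x : Fin n → Value} → Injective _≡_ _≈_ x →
                  ∀ {i j} → IsBest x i → IsBest x j → i ≡ j
  isBest-unique x-injective {i} {j} best-i best-j = x-injective (antisym (best-j i) (best-i j))

  -- For distinct values, such a `j` is the last record before `i`.
  Leader : ∀ {n} → (Fin n → Value) → Fin n → Fin n → Set ℓ₂
  Leader x i j = toℕ j < toℕ i × (∀ u → toℕ u < toℕ i → x u ≼ x j)

  leader : ∀ {n} (x : Fin n → Value) i → 0 < toℕ i → ∃[ j ] Leader x i j
  leader {suc n} x i 0<i = argmax x zero before , j<i , λ u u<i →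
    All.lookup (f[xs]≤f[argmax] {f = x} zero before) (∈-filter⁺ (Fin._<? i) (∈-allFin u) u<i)
    where
    before = filter (Fin._<? i) (allFin (suc n))
    -- The default `zero` is itself a candidate for `argmax`, so it too must lie before `i`; this is
    -- what `0<i` provides.
    j<i = argmax-all x {P = λ j → toℕ j < toℕ i} 0<i
      (All.tabulate λ u∈ → proj₂ (∈-filter⁻ (Fin._<? i) {xs = allFin (suc n)} u∈))

  -- When `𝒜` stops at the best item

  module _ {n} {x : Fin n → Value} {i s : Fin n} where

    -- The best item is a record after the signal, so the search ends by time `i`. Ending earlier
    -- would require a record between `s` and `i`.
    stopTime-𝒜⁺ : IsBest x i → toℕ s ≤ toℕ i →
                  (∀ t → toℕ s ≤ toℕ t → toℕ t < toℕ i → ¬ IsRecord x t) →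
                  stopTime 𝒜 x s ≡ just i
    stopTime-𝒜⁺ best s≤i no-record
      with u , u≤i , stops-u , found ← findᵇ-tabulate (stops x s) id i (stops⁺ x s s≤i λ u _ → best u)
      with ℕ.m≤n⇒m<n∨m≡n u≤i
    ... | inj₂ u≡i = trans found (cong just (Fin.toℕ-injective u≡i))
    ... | inj₁ u<i with s≤u , record-u ← stops⁻ x s u stops-u =
      contradiction record-u (no-record u s≤u u<i)

    -- A record `t` in this range would end the search by time `t`, hence before `i`.
    stopTime-𝒜⁻ : stopTime 𝒜 x s ≡ just i →
                  ∀ t → toℕ s ≤ toℕ t → toℕ t < toℕ i → ¬ IsRecord x t
    stopTime-𝒜⁻ stopped t s≤t t<i record-t
      with u , u≤t , _ , found ← findᵇ-tabulate (stops x s) id t (stops⁺ x s s≤t record-t)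
      with refl ← just-injective (trans (sym found) stopped) = ℕ.<⇒≱ t<i u≤t

    module _ {j : Fin n} (j-leader : Leader x i j) where

      -- A record strictly between `j` and `i` would be at least as good as the item at `j`, and no
      -- better since `j` leads; injectivity would put both at the same time.
      stopTime-𝒜-after-leader : Injective _≡_ _≈_ x → IsBest x i →
        toℕ j < toℕ s → toℕ s ≤ toℕ i → stopTime 𝒜 x s ≡ just i
      stopTime-𝒜-after-leader x-injective best j<s s≤i =
        stopTime-𝒜⁺ best s≤i λ t s≤t t<i record-t →
          let j<t = ℕ.<-≤-trans j<s s≤t
              _ , j-leads = j-leader
          in ℕ.<⇒≢ j<t (cong toℕ (x-injective (antisym (record-t j j<t) (j-leads t t<i))))

      -- The leader beats everything before `i`, in particular everything before itself, so it is a
      -- record which `𝒜` accepts unless it has stopped even earlier.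
      stopTime-𝒜-upto-leader : toℕ s ≤ toℕ j → ¬ stopTime 𝒜 x s ≡ just i
      stopTime-𝒜-upto-leader s≤j stopped =
        let j<i , j-leads = j-leader in
        stopTime-𝒜⁻ stopped j s≤j j<i λ u u<j → j-leads u (ℕ.<-trans u<j j<i)

  -- Pairing an arrival order with its reversal before the best time

  stopsAt? : ∀ {n} (x : Fin n → Value) (i s : Fin n) → Dec (stopTime 𝒜 x s ≡ just i)
  stopsAt? x i s = Maybe.≡-dec Fin._≟_ (stopTime 𝒜 x s) (just i)

  -- When `i` is the best time of `x`, this is the success probability given the arrival order.
  -- Leaving `i` free allows arguments from `IsBest x i` alone.
  conditionalSuccess : ∀ {n} → (Fin n → Value) → Fin n → ℚ
  conditionalSuccess x i = mean (signalTimes i) (λ s → indicator (stopsAt? x i s))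

  module _ {n} {x y : Fin (suc n) → Value}
           (x-injective : Injective _≡_ _≈_ x) (y-injective : Injective _≡_ _≈_ y)
           {i : Fin (suc n)} (x-best : IsBest x i) (y≗ : y ≗ x ∘ reverseBefore i) where

    private
      ρ = reverseBefore i
      ρρ = reverseBefore-involutive i

      y-best : IsBest y i
      y-best = subst (IsBest y) (reverseBefore-fixed i) (isBest-∘ ρ ρρ y≗ x-best)

    -- Reversal permutes the items before `i` among themselves, so the best of them is the same item
    -- at its new time.
    leader-reverse : ∀ {j} → Leader x i j → Leader y i (ρ j)
    leader-reverse {j} (j<i , j-leads) =
      reversePrefix-< (toℕ i) (Fin.toℕ≤n i) j<i , λ u u<i →
        subst₂ _≼_ (sym (y≗ u)) (sym (trans (y≗ (ρ j)) (cong x (ρρ j))))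
          (j-leads (ρ u) (reversePrefix-< (toℕ i) (Fin.toℕ≤n i) u<i))

    module _ {s : Fin (suc n)} (s≤i : toℕ s ≤ toℕ i) where

      private
        s′ = reverseUpTo i s

        s′≡ : toℕ s′ ≡ toℕ i ∸ toℕ s
        s′≡ = toℕ-reversePrefix (suc (toℕ i)) (Fin.toℕ<n i) (s≤s s≤i)

        s′≤i : toℕ s′ ≤ toℕ i
        s′≤i = subst (_≤ toℕ i) (sym s′≡) (ℕ.m∸n≤m (toℕ i) (toℕ s))

      both-stop : i ≡ zero →
        indicator (stopsAt? x i s) + indicator (stopsAt? y i s′) ≡ 1ℚ + 1ℚ
      both-stop refl = indicator-+-yes-yes (stopsAt? x i s) (stopsAt? y i s′)
        (stopTime-𝒜⁺ x-best s≤i λ _ _ ()) (stopTime-𝒜⁺ y-best s′≤i λ _ _ ())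

      one-stops : ∃[ j ] Leader x i j →
        indicator (stopsAt? x i s) + indicator (stopsAt? y i s′) ≡ 1ℚ
      one-stops (j , j-leader@(j<i , _)) = by-cases (toℕ j ℕ.<? toℕ s)
        where
        j′≡ : toℕ (ρ j) ≡ toℕ i ∸ suc (toℕ j)
        j′≡ = toℕ-reversePrefix (toℕ i) (Fin.toℕ≤n i) j<i

        by-cases : Dec (toℕ j < toℕ s) →
          indicator (stopsAt? x i s) + indicator (stopsAt? y i s′) ≡ 1ℚ
        -- From `j + 1 ≤ s` follows `i - s ≤ i - (j + 1)`: the reflected signal comes no later than
        -- the reflected leader.
        by-cases (yes j<s) = indicator-+-yes-no (stopsAt? x i s) (stopsAt? y i s′)
          (stopTime-𝒜-after-leader j-leader x-injective x-best j<s s≤i)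
          (stopTime-𝒜-upto-leader (leader-reverse j-leader)
            (subst₂ _≤_ (sym s′≡) (sym j′≡) (ℕ.∸-monoʳ-≤ (toℕ i) j<s)))
        -- From `s < j + 1` follows `i - (j + 1) < i - s`; with truncated subtraction, strictness
        -- rests on `j + 1 ≤ i`.
        by-cases (no j≮s) = indicator-+-no-yes (stopsAt? x i s) (stopsAt? y i s′)
          (stopTime-𝒜-upto-leader j-leader s≤j)
          (stopTime-𝒜-after-leader (leader-reverse j-leader) y-injective y-best
            (subst₂ _<_ (sym j′≡) (sym s′≡) (ℕ.∸-monoʳ-< (s≤s s≤j) j<i)) s′≤i)
          where s≤j = ℕ.≮⇒≥ j≮s

      stopsAt-reverse : indicator (stopsAt? x i s) + indicator (stopsAt? y i s′) ≡
                        1ℚ + indicator (i Fin.≟ zero)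
      stopsAt-reverse = by-cases (i Fin.≟ zero)
        where
        -- With the decision as an argument, the right-hand side computes to `1ℚ + 1ℚ` or to `1ℚ`.
        by-cases : (i≟0 : Dec (i ≡ zero)) →
          indicator (stopsAt? x i s) + indicator (stopsAt? y i s′) ≡ 1ℚ + indicator i≟0
        by-cases (yes i≡0) = both-stop i≡0
        by-cases (no i≢0)  = one-stops (leader x i (ℕ.n≢0⇒n>0 (i≢0 ∘ Fin.toℕ-injective)))

    -- In the application `k` is the best time of the reversed order, which agrees with `i` only
    -- propositionally.
    conditionalSuccess-reverse : ∀ {k} → k ≡ i →
      conditionalSuccess x i + conditionalSuccess y k ≡ 1ℚ + indicator (i Fin.≟ zero)
    conditionalSuccess-reverse refl = mean-signalTimes-pairing i
      (λ s → indicator (stopsAt? x i s)) (λ s → indicator (stopsAt? y i s)) stopsAt-reverse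

  conditionalSuccess-bestTime : ∀ {n} (x : Fin (suc n) → Value) {i} → bestTime x ≡ i →
    mean (filter (Fin._≤? bestTime x) (allFin (suc n))) (λ s → indicator (succeeds? 𝒜 (x , s))) ≡
    conditionalSuccess x i
  conditionalSuccess-bestTime {n} x refl =
    mean-cong (filter (Fin._≤? bestTime x) (allFin (suc n))) λ {s} _ →
      indicator-⇔ (succeeds? 𝒜 (x , s)) (stopsAt? x (bestTime x) s) id id

  -- Averaging over the arrival orders

  module _ {n} (v : Fin (suc n) → Value) (v-injective : Injective _≡_ _≈_ v) where

    private orders = arrivalOrders (suc n)

    values : Vec (Fin (suc n)) (suc n) → Fin (suc n) → Value
    values σ t = v (lookup σ t)

    values-injective : ∀ {σ} → σ ∈ orders → Injective _≡_ _≈_ (values σ)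
    values-injective σ∈ eq = Vec.lookup-injective (∈-arrivalOrders⁻ σ∈) _ _ (v-injective eq)

    values-permute : ∀ ρ σ → values (permute ρ σ) ≗ values σ ∘ ρ
    values-permute ρ σ t = cong v (lookup∘tabulate (lookup σ ∘ ρ) t)

    -- Opaque, because the conversion checker otherwise unfolds bestTime at great cost.
    opaque

      best : Vec (Fin (suc n)) (suc n) → Fin (suc n)
      best σ = bestTime (values σ)

      best≡bestTime : ∀ σ → bestTime (values σ) ≡ best σ
      best≡bestTime σ = refl

    best-isBest : ∀ σ → IsBest (values σ) (best σ)
    best-isBest σ = subst (IsBest (values σ)) (best≡bestTime σ) (bestTime-isBest (values σ))

    -- Both sides are best times of the permuted sequence, and distinct values allow only one.
    best-permute : ∀ (ρ : Fin (suc n) → Fin (suc n)) → (∀ t → ρ (ρ t) ≡ t) →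
      ∀ {σ} → σ ∈ orders → best (permute ρ σ) ≡ ρ (best σ)
    best-permute ρ ρρ {σ} σ∈ = isBest-unique {x = values (permute ρ σ)}
      (values-injective (permute-∈-arrivalOrders ρ ρρ σ∈))
      (best-isBest (permute ρ σ))
      (isBest-∘ {x = values σ} ρ ρρ (values-permute ρ σ) (best-isBest σ))

    successGiven : Vec (Fin (suc n)) (suc n) → ℚ
    successGiven σ = conditionalSuccess (values σ) (best σ)

    successGiven-reverse : ∀ {σ} → σ ∈ orders →
      successGiven σ + successGiven (permute (reverseBefore (best σ)) σ) ≡
      1ℚ + indicator (best σ Fin.≟ zero)
    successGiven-reverse {σ} σ∈ = conditionalSuccess-reverse {x = values σ} {y = values (permute ρ σ)}
      (values-injective σ∈) (values-injective (permute-∈-arrivalOrders ρ ρρ σ∈))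
      {i = best σ} (best-isBest σ) (values-permute ρ σ)
      {k = best (permute ρ σ)} (trans (best-permute ρ ρρ σ∈) (reverseBefore-fixed (best σ)))
      where
      ρ = reverseBefore (best σ)
      ρρ = reverseBefore-involutive (best σ)

    -- The right-hand side repeats the terms in experiment literally: were values and best folded
    -- in, comparing the two sides would be exponentially slow.
    successProbability≡mean : successProbability v 𝒜 ≡
      mean (arrivalOrders (suc n)) (λ σ →
        mean (filter (Fin._≤? bestTime (λ t → v (lookup σ t))) (allFin (suc n)))
          (λ s → indicator (succeeds? 𝒜 ((λ t → v (lookup σ t)) , s))))
    successProbability≡mean =
      Pr-uniform-uniform (succeeds? 𝒜) (arrivalOrders (suc n))
        (λ σ → filter (Fin._≤? bestTime (λ t → v (lookup σ t))) (allFin (suc n)))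
        (λ σ s → (λ t → v (lookup σ t)) , s)

    successProbability≡successGiven : successProbability v 𝒜 ≡ mean orders successGiven
    successProbability≡successGiven = trans successProbability≡mean
      (mean-cong orders λ {σ} _ → conditionalSuccess-bestTime (λ t → v (lookup σ t)) (best≡bestTime σ))

    successProbability-doubled :
      successProbability v 𝒜 + successProbability v 𝒜 ≡ 1ℚ + 1ℤ / suc n
    successProbability-doubled = trans
      (cong₂ _+_ successProbability≡successGiven successProbability≡successGiven)
      (mean-reverseBefore best best-permute successGiven successGiven-reverse)

-- Closed forms of the success probability

module _ (n : ℕ) where

  private
    N = suc n
    -- The fraction lemmas take denominators in the form `suc d`.
    d = ℕ.pred (2 ℕ.* N)

    2N≡N+N : + (2 ℕ.* N) ≡ + N ℤ.+ + N
    2N≡N+N = cong (λ k → + (N ℕ.+ k)) (ℕ.+-identityʳ N)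

  -- Cross-multiplication leaves a polynomial identity in `N`, once `2 * N` is rewritten as `N + N`.
  [N+1]/2N+[N+1]/2N : (+ N ℤ.+ 1ℤ) / (2 ℕ.* N) + (+ N ℤ.+ 1ℤ) / (2 ℕ.* N) ≡ 1ℚ + 1ℤ / N
  [N+1]/2N+[N+1]/2N = trans (/-+-/ k k d d)
    -- The last two arguments are the predecessors of the denominators `2N * 2N` and `1 * N` which
    -- `/-+-/` produces.
    (trans (/-≡-/ (k ℤ.* D ℤ.+ k ℤ.* D) (1ℤ ℤ.* + N ℤ.+ 1ℤ ℤ.* 1ℤ) (d ℕ.+ d ℕ.* suc d) (n ℕ.+ 0)
      (trans
        (cong (λ m → (k ℤ.* D ℤ.+ k ℤ.* D) ℤ.* + suc m) (ℕ.+-identityʳ n))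
        (subst
          (λ D → (k ℤ.* D ℤ.+ k ℤ.* D) ℤ.* + N ≡ (1ℤ ℤ.* + N ℤ.+ 1ℤ ℤ.* 1ℤ) ℤ.* (D ℤ.* D))
          (sym 2N≡N+N) (identity (+ N)))))
    (sym (/-+-/ 1ℤ 1ℤ 0 n)))
    where
    k = + N ℤ.+ 1ℤ
    D = + (2 ℕ.* N)
    identity : ∀ m → let k = m ℤ.+ 1ℤ; D = m ℤ.+ m in
      (k ℤ.* D ℤ.+ k ℤ.* D) ℤ.* m ≡ (1ℤ ℤ.* m ℤ.+ 1ℤ ℤ.* 1ℤ) ℤ.* (D ℤ.* D)
    identity = ℤ.solve-∀

  1/N+[N-1]/2N≡[N+1]/2N :
    1ℤ / N + (+ N ℤ.- 1ℤ) / (2 ℕ.* N) ≡ (+ N ℤ.+ 1ℤ) / (2 ℕ.* N)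
  1/N+[N-1]/2N≡[N+1]/2N = trans
    (/-+-/ 1ℤ (+ N ℤ.- 1ℤ) n d)
    (/-≡-/ (1ℤ ℤ.* D ℤ.+ (+ N ℤ.- 1ℤ) ℤ.* + N) (+ N ℤ.+ 1ℤ) (d ℕ.+ n ℕ.* suc d) d
      (subst (λ D → (1ℤ ℤ.* D ℤ.+ (+ N ℤ.- 1ℤ) ℤ.* + N) ℤ.* D ≡ (+ N ℤ.+ 1ℤ) ℤ.* (+ N ℤ.* D))
        (sym 2N≡N+N) (identity (+ N))))
    where
    D = + (2 ℕ.* N)
    identity : ∀ m → let D = m ℤ.+ m in
      (1ℤ ℤ.* D ℤ.+ (m ℤ.- 1ℤ) ℤ.* m) ℤ.* D ≡ (m ℤ.+ 1ℤ) ℤ.* (m ℤ.* D)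
    identity = ℤ.solve-∀

  -- Cross-multiplied, the claim is `2N < (N + 1) * 2`.
  [N+1]/2N>½ : (+ N ℤ.+ 1ℤ) / (2 ℕ.* N) > ½
  [N+1]/2N>½ = toℚᵘ-cancel-<
    (ℚᵘ.<-respʳ-≃ (ℚᵘ.≃-sym (toℚᵘ-fromℚᵘ r)) (ℚᵘ.*<* (ℤ.+<+ 1*2N<[N+1]*2)))
    where
    r = ℚᵘ.mkℚᵘ (+ N ℤ.+ 1ℤ) d
    1*2N<[N+1]*2 : 1 ℕ.* (2 ℕ.* N) ℕ.< (N ℕ.+ 1) ℕ.* 2
    1*2N<[N+1]*2 = subst (ℕ._< (N ℕ.+ 1) ℕ.* 2)
      (trans (ℕ.*-comm N 2) (sym (ℕ.*-identityˡ (2 ℕ.* N))))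
      (ℕ.*-monoˡ-< 2 (ℕ.m<m+n N z<s))

mainTheorem10 : ∀ {c ℓ₁ ℓ₂} (O : DecTotalOrder c ℓ₁ ℓ₂) →
    (n : ℕ) .{{_ : NonZero n}} (v : Fin n → DecTotalOrder.Carrier O) →
    Injective _≡_ (DecTotalOrder._≈_ O) v →
    let instance _ = m*n≢0 2 n in
    (Secretary.successProbability O v 𝒜 ≡ 1ℤ / n + (+ n ℤ.- 1ℤ) / (2 ℕ.* n)) ×
    (1ℤ / n + (+ n ℤ.- 1ℤ) / (2 ℕ.* n) ≡ (+ n ℤ.+ 1ℤ) / (2 ℕ.* n)) ×
    ((+ n ℤ.+ 1ℤ) / (2 ℕ.* n) > ½)
mainTheorem10 O (suc n) v v-injective =
  trans successProbability≡[N+1]/2N (sym (1/N+[N-1]/2N≡[N+1]/2N n)) ,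
  1/N+[N-1]/2N≡[N+1]/2N n ,
  [N+1]/2N>½ n
  where
  successProbability≡[N+1]/2N :
    Secretary.successProbability O v 𝒜 ≡ (+ suc n ℤ.+ 1ℤ) / (2 ℕ.* suc n)
  -- Doubling either side gives `1 + 1/(n + 1)`, where `suc n` is the number of items.
  successProbability≡[N+1]/2N = p+p≡q+q⇒p≡q
    (trans (successProbability-doubled O v v-injective) (sym ([N+1]/2N+[N+1]/2N n)))
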